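{- Let $n,m\ge2$ be integers and let $K_n,K_m$ be the complete graphs on $n$ and $m$ vertices. Then $\mathrm{mr}_+^{\mathbb{R}}(K_n\,\Box\,K_m)$ is either $n+m-2$ or $n+m-1$.
   Context: For an $N\times N$ real symmetric matrix $A$, $\mathcal{G}(A)$ is the simple graph on $\{1,\dots,N\}$ in which distinct $i,j$ are adjacent iff $A_{ij}\ne0$ (the diagonal is unconstrained). For a simple graph $G$ on $N$ vertices, $\mathrm{mr}_+^{\mathbb{R}}(G)$ is the minimum rank of a real symmetric positive semidefinite $N\times N$ matrix $B$ with $\mathcal{G}(B)=G$. The Cartesian product $G_1\,\Box\,G_2$ of $G_1=(V_1,E_1)$ and $G_2=(V_2,E_2)$ has vertex set $V_1\times V_2$, with $(u,v)$ adjacent to $(u',v')$ iff (1) $u=u'$ and $\{v,v'\}\in E_2$, or (2) $v=v'$ and $\{u,u'\}\in E_1$. -}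

module Defs where

open import Algebra.Bundles.Raw using (RawMonoid)
open import Data.Fin.Base using (Fin)
open import Data.Nat.Base as ℕ using (ℕ; _⊔_)
import Data.Nat.Properties as ℕ
open import Data.Product.Base using (Σ; ∃; _×_; _,_; proj₁; proj₂)
open import Data.Rational.Base as ℚ using (ℚ; 0ℚ; 1ℚ; ½; ∣_∣)
import Data.Rational.Properties as ℚ
open import Data.Rational.Solver using (module +-*-Solver)
open import Data.Sum.Base using (_⊎_; inj₁; inj₂)
open import Data.Vec.Functional using (Vector)
open import Function.Base using (_∘_)
open import Function.Bundles using (_⇔_; _↔_; Inverse)
open import Level using (0ℓ)
open import Relation.Binary.PropositionalEquality
  using (_≡_; _≢_; refl; sym; trans; cong; subst)
open import Relation.Nullary.Negation using (¬_)

------------------------------------------------------------------------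
-- Real numbers: Cauchy sequences of rationals, with the setoid equality
-- "the difference tends to 0".

-- P holds for all sufficiently large indices.
Eventually : (ℕ → Set) → Set
Eventually P = ∃ λ N → ∀ n → N ℕ.≤ n → P n

IsCauchy : (ℕ → ℚ) → Set
IsCauchy x = ∀ ε → 0ℚ ℚ.< ε →
  ∃ λ N → ∀ m n → N ℕ.≤ m → N ℕ.≤ n → ∣ x m ℚ.- x n ∣ ℚ.< ε

record ℝ : Set where
  constructor mkℝ
  field
    seq    : ℕ → ℚ
    cauchy : IsCauchy seq

open ℝ public

infix 4 _≈_ _≤_

_≈_ : ℝ → ℝ → Set
x ≈ y = ∀ ε → 0ℚ ℚ.< ε → Eventually λ n → ∣ seq x n ℚ.- seq y n ∣ ℚ.< ε

_≤_ : ℝ → ℝ → Set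
x ≤ y = ∀ ε → 0ℚ ℚ.< ε → Eventually λ n → seq x n ℚ.≤ seq y n ℚ.+ ε

half-pos : ∀ ε → 0ℚ ℚ.< ε → 0ℚ ℚ.< ½ ℚ.* ε
half-pos ε 0<ε = subst (ℚ._< ½ ℚ.* ε) (ℚ.*-zeroʳ ½) (ℚ.*-monoʳ-<-pos ½ 0<ε)

halves : ∀ ε → ½ ℚ.* ε ℚ.+ ½ ℚ.* ε ≡ ε
halves ε = trans (sym (ℚ.*-distribʳ-+ ε ½ ½)) (ℚ.*-identityˡ ε)

∣+∣<ε : ∀ p q ε → ∣ p ∣ ℚ.< ½ ℚ.* ε → ∣ q ∣ ℚ.< ½ ℚ.* ε → ∣ p ℚ.+ q ∣ ℚ.< ε
∣+∣<ε p q ε p< q< = subst (∣ p ℚ.+ q ∣ ℚ.<_) (halves ε)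
  (ℚ.≤-<-trans (ℚ.∣p+q∣≤∣p∣+∣q∣ p q) (ℚ.+-mono-< p< q<))

∣-∣-swap : ∀ p q → ∣ p ℚ.- q ∣ ≡ ∣ q ℚ.- p ∣
∣-∣-swap p q = trans (sym (ℚ.∣-p∣≡∣p∣ (p ℚ.- q)))
  (cong ∣_∣ (solve 2 (λ a b → :- (a :- b) := b :- a) refl p q))
  where open +-*-Solver

add-sub : ∀ a b c → (a ℚ.- b) ℚ.+ (b ℚ.- c) ≡ a ℚ.- c
add-sub = solve 3 (λ a b c → (a :- b) :+ (b :- c) := a :- c) refl
  where open +-*-Solver

≈-sym : ∀ {x y} → x ≈ y → y ≈ x
≈-sym {x} {y} x≈y ε 0<ε =
  let N , h = x≈y ε 0<ε
  in  N , λ n N≤n → subst (ℚ._< ε) (∣-∣-swap (seq x n) (seq y n)) (h n N≤n)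

≈-trans : ∀ {x y z} → x ≈ y → y ≈ z → x ≈ z
≈-trans {x} {y} {z} x≈y y≈z ε 0<ε =
  let N₁ , h₁ = x≈y (½ ℚ.* ε) (half-pos ε 0<ε)
      N₂ , h₂ = y≈z (½ ℚ.* ε) (half-pos ε 0<ε)
  in  N₁ ⊔ N₂ , λ n N≤n →
        subst (λ t → ∣ t ∣ ℚ.< ε) (add-sub (seq x n) (seq y n) (seq z n))
          (∣+∣<ε _ _ ε (h₁ n (ℕ.m⊔n≤o⇒m≤o N₁ N₂ N≤n))
                       (h₂ n (ℕ.m⊔n≤o⇒n≤o N₁ N₂ N≤n)))

fromℚ : ℚ → ℝ
fromℚ q = mkℝ (λ _ → q) λ ε 0<ε →
  0 , λ _ _ _ _ → subst (λ t → ∣ t ∣ ℚ.< ε) (sym (ℚ.+-inverseʳ q)) 0<ε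

0ℝ : ℝ
0ℝ = fromℚ 0ℚ

infixl 6 _+_
infixl 7 _*_

_+_ : ℝ → ℝ → ℝ
x + y = mkℝ (λ n → seq x n ℚ.+ seq y n) λ ε 0<ε →
  let N₁ , h₁ = cauchy x (½ ℚ.* ε) (half-pos ε 0<ε)
      N₂ , h₂ = cauchy y (½ ℚ.* ε) (half-pos ε 0<ε)
  in  N₁ ⊔ N₂ , λ m n N≤m N≤n →
        subst (λ t → ∣ t ∣ ℚ.< ε) (rearrange (seq x m) (seq x n) (seq y m) (seq y n))
          (∣+∣<ε _ _ ε
            (h₁ m n (ℕ.m⊔n≤o⇒m≤o N₁ N₂ N≤m) (ℕ.m⊔n≤o⇒m≤o N₁ N₂ N≤n))
            (h₂ m n (ℕ.m⊔n≤o⇒n≤o N₁ N₂ N≤m) (ℕ.m⊔n≤o⇒n≤o N₁ N₂ N≤n)))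
  where
  rearrange : ∀ a b c d → (a ℚ.- b) ℚ.+ (c ℚ.- d) ≡ (a ℚ.+ c) ℚ.- (b ℚ.+ d)
  rearrange = solve 4 (λ a b c d → (a :- b) :+ (c :- d) := (a :+ c) :- (b :+ d)) refl
    where open +-*-Solver

bounded : ∀ x → ∃ λ B → 0ℚ ℚ.< B × Eventually λ n → ∣ seq x n ∣ ℚ.≤ B
bounded x = B , 0<B , N , λ n N≤n → ℚ.<⇒≤ (bound n N≤n)
  where
  N   = proj₁ (cauchy x 1ℚ (ℚ.positive⁻¹ 1ℚ))
  h   = proj₂ (cauchy x 1ℚ (ℚ.positive⁻¹ 1ℚ))
  B   = 1ℚ ℚ.+ ∣ seq x N ∣
  0<B : 0ℚ ℚ.< B
  0<B = ℚ.+-mono-<-≤ (ℚ.positive⁻¹ 1ℚ) (ℚ.0≤∣p∣ (seq x N))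
  restore : ∀ a b → (a ℚ.- b) ℚ.+ b ≡ a
  restore = solve 2 (λ a b → (a :- b) :+ b := a) refl
    where open +-*-Solver
  bound : ∀ n → N ℕ.≤ n → ∣ seq x n ∣ ℚ.< B
  bound n N≤n = subst (λ t → ∣ t ∣ ℚ.< B) (restore (seq x n) (seq x N))
    (ℚ.≤-<-trans (ℚ.∣p+q∣≤∣p∣+∣q∣ (seq x n ℚ.- seq x N) (seq x N))
      (ℚ.+-mono-<-≤ (h n N N≤n ℕ.≤-refl) ℚ.≤-refl))

-- Some δ > 0 is so small that a factor bounded by B and one below δ have
-- product below ε.
shrink : ∀ B ε → 0ℚ ℚ.< B → 0ℚ ℚ.< ε →
  ∃ λ δ → 0ℚ ℚ.< δ × (∀ p q → ∣ p ∣ ℚ.≤ B → ∣ q ∣ ℚ.< δ → ∣ p ℚ.* q ∣ ℚ.< ε)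
shrink B ε 0<B 0<ε = δ , 0<δ , small
  where
  instance
    B-pos : ℚ.Positive B
    B-pos = ℚ.positive 0<B
    B-nonZero : ℚ.NonZero B
    B-nonZero = ℚ.pos⇒nonZero B
    1/B-pos : ℚ.Positive (ℚ.1/ B)
    1/B-pos = ℚ.1/pos⇒pos B
  δ = ℚ.1/ B ℚ.* ε
  0<δ : 0ℚ ℚ.< δ
  0<δ = subst (ℚ._< δ) (ℚ.*-zeroʳ (ℚ.1/ B)) (ℚ.*-monoʳ-<-pos (ℚ.1/ B) 0<ε)
  Bδ≡ε : B ℚ.* δ ≡ ε
  Bδ≡ε = trans (sym (ℚ.*-assoc B (ℚ.1/ B) ε))
    (trans (cong (ℚ._* ε) (ℚ.*-inverseʳ B)) (ℚ.*-identityˡ ε))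
  small : ∀ p q → ∣ p ∣ ℚ.≤ B → ∣ q ∣ ℚ.< δ → ∣ p ℚ.* q ∣ ℚ.< ε
  small p q p≤B q<δ = subst (ℚ._< ε) (sym (ℚ.∣p*q∣≡∣p∣*∣q∣ p q))
    (ℚ.≤-<-trans
      (ℚ.*-monoʳ-≤-nonNeg ∣ q ∣ {{ℚ.∣-∣-nonNeg q}} p≤B)
      (subst (B ℚ.* ∣ q ∣ ℚ.<_) Bδ≡ε (ℚ.*-monoʳ-<-pos B q<δ)))

_*_ : ℝ → ℝ → ℝ
x * y = mkℝ (λ n → seq x n ℚ.* seq y n) λ ε 0<ε →
  let B , 0<B , M₁ , x≤B = bounded x
      C , 0<C , M₂ , y≤C = bounded y
      δ , 0<δ , small₁ = shrink B (½ ℚ.* ε) 0<B (half-pos ε 0<ε)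
      η , 0<η , small₂ = shrink C (½ ℚ.* ε) 0<C (half-pos ε 0<ε)
      N₁ , h₁ = cauchy y δ 0<δ
      N₂ , h₂ = cauchy x η 0<η
      ≥M = λ (k : ℕ) → ℕ.m⊔n≤o⇒m≤o {k} (M₁ ⊔ M₂) (N₁ ⊔ N₂)
      ≥N = λ (k : ℕ) → ℕ.m⊔n≤o⇒n≤o {k} (M₁ ⊔ M₂) (N₁ ⊔ N₂)
  in  (M₁ ⊔ M₂) ⊔ (N₁ ⊔ N₂) , λ m n N≤m N≤n →
        subst (λ t → ∣ t ∣ ℚ.< ε) (rearrange (seq x m) (seq x n) (seq y m) (seq y n))
          (∣+∣<ε _ _ ε
            (small₁ (seq x m) (seq y m ℚ.- seq y n)
              (x≤B m (ℕ.m⊔n≤o⇒m≤o M₁ M₂ (≥M m N≤m)))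
              (h₁ m n (ℕ.m⊔n≤o⇒m≤o N₁ N₂ (≥N m N≤m)) (ℕ.m⊔n≤o⇒m≤o N₁ N₂ (≥N n N≤n))))
            (small₂ (seq y n) (seq x m ℚ.- seq x n)
              (y≤C n (ℕ.m⊔n≤o⇒n≤o M₁ M₂ (≥M n N≤n)))
              (h₂ m n (ℕ.m⊔n≤o⇒n≤o N₁ N₂ (≥N m N≤m)) (ℕ.m⊔n≤o⇒n≤o N₁ N₂ (≥N n N≤n)))))
  where
  rearrange : ∀ a b c d →
    (a ℚ.* (c ℚ.- d)) ℚ.+ (d ℚ.* (a ℚ.- b)) ≡ (a ℚ.* c) ℚ.- (b ℚ.* d)
  rearrange = solve 4
    (λ a b c d → (a :* (c :- d)) :+ (d :* (a :- b)) := (a :* c) :- (b :* d)) refl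
    where open +-*-Solver

+-rawMonoid : RawMonoid 0ℓ 0ℓ
+-rawMonoid = record { Carrier = ℝ ; _≈_ = _≈_ ; _∙_ = _+_ ; ε = 0ℝ }

open import Algebra.Definitions.RawMonoid +-rawMonoid public using (sum)

------------------------------------------------------------------------
-- Matrices

Matrix : ℕ → Set
Matrix N = Fin N → Fin N → ℝ

Symmetric : ∀ {N} → Matrix N → Set
Symmetric A = ∀ i j → A i j ≈ A j i

PositiveSemidefinite : ∀ {N} → Matrix N → Set
PositiveSemidefinite {N} A =
  ∀ (x : Vector ℝ N) → 0ℝ ≤ sum λ i → sum λ j → x i * (A i j * x j)

LinearlyIndependent : ∀ {N s} → (Fin s → Vector ℝ N) → Set
LinearlyIndependent {N} {s} v =
  ∀ (c : Vector ℝ s) → (∀ i → sum (λ k → c k * v k i) ≈ 0ℝ) → ∀ k → c k ≈ 0ℝ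

column : ∀ {N} → Matrix N → Fin N → Vector ℝ N
column A j = λ i → A i j

-- An independent family of columns automatically has distinct indices.
IndependentColumns : ∀ {N} → Matrix N → ℕ → Set
IndependentColumns {N} A s =
  ∃ λ (f : Fin s → Fin N) → LinearlyIndependent (column A ∘ f)

HasRank : ∀ {N} → Matrix N → ℕ → Set
HasRank A r = IndependentColumns A r × (∀ s → IndependentColumns A s → s ℕ.≤ r)

------------------------------------------------------------------------
-- Graphs

record SimpleGraph (V : Set) : Set₁ where
  field
    Adj         : V → V → Set
    symmetric   : ∀ {u v} → Adj u v → Adj v u
    irreflexive : ∀ {u} → ¬ Adj u u

open SimpleGraph public

infix 4 _≗ᴳ_

_≗ᴳ_ : ∀ {V} → SimpleGraph V → SimpleGraph V → Set
G ≗ᴳ H = ∀ u v → Adj G u v ⇔ Adj H u v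

K : ∀ n → SimpleGraph (Fin n)
K n = record
  { Adj         = _≢_
  ; symmetric   = λ u≢v v≡u → u≢v (sym v≡u)
  ; irreflexive = λ u≢u → u≢u refl
  }

infixr 7 _□_

_□_ : ∀ {V W} → SimpleGraph V → SimpleGraph W → SimpleGraph (V × W)
G □ H = record
  { Adj         = λ (u , v) (u′ , v′) →
                    (u ≡ u′ × Adj H v v′) ⊎ (v ≡ v′ × Adj G u u′)
  ; symmetric   = λ { (inj₁ (refl , e)) → inj₁ (refl , symmetric H e)
                    ; (inj₂ (refl , e)) → inj₂ (refl , symmetric G e) }
  ; irreflexive = λ { (inj₁ (_ , e)) → irreflexive H e
                    ; (inj₂ (_ , e)) → irreflexive G e }
  }

-- The same graph with its vertices numbered along a bijection.
relabel : ∀ {N V} → Fin N ↔ V → SimpleGraph V → SimpleGraph (Fin N)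
relabel φ G = record
  { Adj         = λ i j → Adj G (Inverse.to φ i) (Inverse.to φ j)
  ; symmetric   = symmetric G
  ; irreflexive = irreflexive G
  }

𝒢 : ∀ {N} (A : Matrix N) → Symmetric A → SimpleGraph (Fin N)
𝒢 A A-sym = record
  { Adj         = λ i j → i ≢ j × ¬ (A i j ≈ 0ℝ)
  ; symmetric   = λ {i} {j} (i≢j , Aij≉0) →
      (λ j≡i → i≢j (sym j≡i)) ,
      (λ Aji≈0 → Aij≉0 (≈-trans {A i j} {A j i} {0ℝ} (A-sym i j) Aji≈0))
  ; irreflexive = λ (i≢i , _) → i≢i refl
  }

------------------------------------------------------------------------
-- Positive semidefinite minimum rank

PSDRealization : ∀ {N} → SimpleGraph (Fin N) → Matrix N → Set
PSDRealization G B =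
  Σ (Symmetric B) λ B-sym → PositiveSemidefinite B × 𝒢 B B-sym ≗ᴳ G

-- mr₊(G) = r, as a relation: r is attained and is least.
IsMr₊ : ∀ {N} → SimpleGraph (Fin N) → ℕ → Set
IsMr₊ G r =
  (∃ λ B → PSDRealization G B × HasRank B r) ×
  (∀ B s → PSDRealization G B → HasRank B s → r ℕ.≤ s)

{-# OPTIONS --safe #-}
module Submission where

-- Lower bound: in any realization the columns (i,0), i ≠ 1, and (0,j), j ≠ 0,
-- meet the rows (i,1) and (1,j) respectively in a triangular submatrix with
-- nonzero diagonal (a zero forcing argument on the rook graph), so n + m − 2 columns
-- are independent.  Upper bound: the Gram matrix of the vectors eᵢ ⊕ fⱼ
-- realizes the graph, and its columns satisfy every linear relation satisfied
-- by the n m vectors eᵢ ⊕ fⱼ, which span a space of dimension n + m − 1.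
-- Excluded middle then decides which of the two ranks is least.

open import Defs using (IsMr₊; relabel; K; _□_)
open import Axiom.ExcludedMiddle using (ExcludedMiddle)
open import Data.Fin.Properties using (*↔×)
open import Data.Nat.Base using (ℕ; _+_; _∸_; _≤_)
open import Data.Product.Base using (∃; _×_)
open import Data.Sum.Base using (_⊎_)
open import Level using (0ℓ)
open import Relation.Binary.PropositionalEquality using (_≡_)

import Defs as D
open D using (ℝ; seq; cauchy; fromℚ; 0ℝ; half-pos; halves; Matrix; LinearlyIndependent;
  IndependentColumns; HasRank; PSDRealization; SimpleGraph; Adj)
open import Algebra.Bundles using (CommutativeMonoid; CommutativeRing)
import Algebra.Properties.CommutativeMonoid.Sum as CommutativeMonoidSum
import Algebra.Properties.Semiring.Sum as SemiringSum
open import Data.Fin.Base as Fin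
  using (Fin; zero; suc; toℕ; fromℕ<; punchIn; splitAt; _↑ˡ_; _↑ʳ_; join)
import Data.Fin.Properties as Fin
open import Data.Fin.Patterns using (0F; 1F)
open import Data.Nat.Base as ℕ using (zero; suc; z≤n; s≤s; _<_; _⊔_)
open import Data.Nat.Induction using (<-rec)
import Data.Nat.Properties as ℕ
open import Data.Product.Base using (_,_; proj₁; proj₂)
open import Data.Rational.Base as ℚ using (ℚ; 0ℚ; 1ℚ; ½; ∣_∣)
import Data.Rational.Properties as ℚ
open import Data.Rational.Solver using (module +-*-Solver)
open import Data.Sum.Base using (inj₁; inj₂; [_,_]′; map₁; fromInj₁)
open import Data.Vec.Functional using (Vector; insertAt)
open import Data.Vec.Functional.Properties using (insertAt-lookup; insertAt-punchIn)
open import Function.Base using (_∘_)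
open import Function.Bundles using (Inverse; _↔_; mk⇔; Equivalence)
open import Relation.Binary.PropositionalEquality
  using (_≢_; refl; sym; trans; cong; cong₂; subst; subst₂; module ≡-Reasoning)
open import Relation.Nullary.Decidable using (Dec; yes; no; ¬?; decidable-stable)
open import Relation.Nullary.Negation using (¬_; contradiction)

private
  variable
    d r s n m N : ℕ

module ℚΣ = SemiringSum (CommutativeRing.semiring ℚ.+-*-commutativeRing)

open ℚΣ using () renaming (sum to sumℚ)

-- Rational linear algebra

infix 8 _·_

_·_ : Vector ℚ s → Vector ℚ s → ℚ
x · y = sumℚ λ k → x k ℚ.* y k

·-congʳ : ∀ (x : Vector ℚ s) {y z} → (∀ k → y k ≡ z k) → x · y ≡ x · z
·-congʳ x y≗z = ℚΣ.sum-cong-≗ λ k → cong (x k ℚ.*_) (y≗z k)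

·-zeroʳ : ∀ (x : Vector ℚ s) {y} → (∀ k → y k ≡ 0ℚ) → x · y ≡ 0ℚ
·-zeroʳ {s} x y≗0 = trans (·-congʳ x y≗0)
  (trans (ℚΣ.sum-cong-≗ λ k → ℚ.*-zeroʳ (x k)) (ℚΣ.sum-replicate-zero s))

·-distribˡ-+ : ∀ (x y z : Vector ℚ s) → x · (λ k → y k ℚ.+ z k) ≡ x · y ℚ.+ x · z
·-distribˡ-+ x y z = trans (ℚΣ.sum-cong-≗ λ k → ℚ.*-distribˡ-+ (x k) (y k) (z k))
  (ℚΣ.∑-distrib-+ (λ k → x k ℚ.* y k) (λ k → x k ℚ.* z k))

-- The vector combined here is a division-free row operation of elimination; unit coefficients give
-- the subtraction law below.
·-combine : ∀ (x y z : Vector ℚ s) a b →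
  x · (λ k → a ℚ.* y k ℚ.- z k ℚ.* b) ≡ a ℚ.* x · y ℚ.- x · z ℚ.* b
·-combine {zero} x y z a b =
  solve 2 (λ a b → con 0ℚ := a :* con 0ℚ :- con 0ℚ :* b) refl a b
  where open +-*-Solver
·-combine {suc s} x y z a b = trans
  (cong (x 0F ℚ.* (a ℚ.* y 0F ℚ.- z 0F ℚ.* b) ℚ.+_)
    (·-combine (x ∘ suc) (y ∘ suc) (z ∘ suc) a b))
  (solve 7 (λ x y z a b p q →
      x :* (a :* y :- z :* b) :+ (a :* p :- q :* b) :=
      a :* (x :* y :+ p) :- (x :* z :+ q) :* b) refl
    (x 0F) (y 0F) (z 0F) a b ((x ∘ suc) · (y ∘ suc)) ((x ∘ suc) · (z ∘ suc)))
  where open +-*-Solver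

·-distribˡ-- : ∀ (x y z : Vector ℚ s) → x · (λ k → y k ℚ.- z k) ≡ x · y ℚ.- x · z
·-distribˡ-- x y z = begin
  x · (λ k → y k ℚ.- z k)                      ≡⟨ ·-congʳ x (λ k → sym (unit (y k) (z k))) ⟩
  x · (λ k → 1ℚ ℚ.* y k ℚ.- z k ℚ.* 1ℚ)        ≡⟨ ·-combine x y z 1ℚ 1ℚ ⟩
  1ℚ ℚ.* x · y ℚ.- x · z ℚ.* 1ℚ                ≡⟨ unit (x · y) (x · z) ⟩
  x · y ℚ.- x · z                              ∎
  where
  open ≡-Reasoning
  unit : ∀ p q → 1ℚ ℚ.* p ℚ.- q ℚ.* 1ℚ ≡ p ℚ.- q
  unit p q = cong₂ ℚ._-_ (ℚ.*-identityˡ p) (ℚ.*-identityʳ q)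

p*q≡0⇒q≡0 : ∀ p {q} → p ≢ 0ℚ → p ℚ.* q ≡ 0ℚ → q ≡ 0ℚ
p*q≡0⇒q≡0 p {q} p≢0 pq≡0 = begin
  q                        ≡⟨ ℚ.*-identityˡ q ⟨
  1ℚ ℚ.* q                 ≡⟨ cong (ℚ._* q) (ℚ.*-inverseˡ p) ⟨
  ℚ.1/ p ℚ.* p ℚ.* q       ≡⟨ ℚ.*-assoc (ℚ.1/ p) p q ⟩
  ℚ.1/ p ℚ.* (p ℚ.* q)     ≡⟨ cong (ℚ.1/ p ℚ.*_) pq≡0 ⟩
  ℚ.1/ p ℚ.* 0ℚ            ≡⟨ ℚ.*-zeroʳ (ℚ.1/ p) ⟩
  0ℚ                       ∎
  where
  open ≡-Reasoning
  instance
    p-nonZero : ℚ.NonZero p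
    p-nonZero = ℚ.≢-nonZero p≢0

-- Gaussian elimination: the pivot entry Φ 0F p eliminates the unknown x p.
underdetermined : r < s → (Φ : Fin r → Vector ℚ s) →
  ∃ λ x → (∃ λ k → x k ≢ 0ℚ) × ∀ l → x · Φ l ≡ 0ℚ
underdetermined {zero} {suc s} _ Φ = (λ _ → 1ℚ) , (0F , λ ()) , λ ()
underdetermined {suc r} {suc s} (s≤s r<s) Φ
  with Fin.any? (λ p → ¬? (Φ 0F p ℚ.≟ 0ℚ))
... | no Φ₀≗0 =
  let x , x≢0 , xΦ≡0 = underdetermined (ℕ.m<n⇒m<1+n r<s) (Φ ∘ suc)
  in  x , x≢0 , λ
        { zero    → ·-zeroʳ x λ k →
                      decidable-stable (Φ 0F k ℚ.≟ 0ℚ) (λ Φ₀k≢0 → Φ₀≗0 (k , Φ₀k≢0))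
        ; (suc l) → xΦ≡0 l }
... | yes (p , a≢0) = x , (punchIn p k , x≢0) , xΦ≡0
  where
  a = Φ 0F p
  rest : Fin (suc r) → Vector ℚ s
  rest l = Φ l ∘ punchIn p
  -- Equation `l` times the pivot, minus `Φ l p` times the pivot equation, with the cancelled column
  -- `p` omitted.
  Ψ : Fin (suc r) → Vector ℚ s
  Ψ l k = a ℚ.* rest l k ℚ.- rest 0F k ℚ.* Φ l p
  solution = underdetermined r<s (Ψ ∘ suc)
  y = proj₁ solution
  k = proj₁ (proj₁ (proj₂ solution))
  scaled : Vector ℚ s
  scaled k = a ℚ.* y k
  -- Scaling the other unknowns by `a` lets the unknown at `p` be chosen without division, and
  -- `x · Φ l` becomes `y · Ψ l` for every `l`.
  x = insertAt scaled p (ℚ.- (y · rest 0F))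
  x≢0 : x (punchIn p k) ≢ 0ℚ
  x≢0 xk≡0 = proj₂ (proj₁ (proj₂ solution))
    (p*q≡0⇒q≡0 a a≢0 (trans (sym (insertAt-punchIn scaled p _ k)) xk≡0))
  yΨ≡0 : ∀ l → y · Ψ l ≡ 0ℚ
  -- `Ψ 0F` vanishes identically, so the pivot equation puts no condition on `y`.
  yΨ≡0 zero    = ·-zeroʳ y λ k →
    trans (cong (ℚ._- rest 0F k ℚ.* a) (ℚ.*-comm a (rest 0F k)))
      (ℚ.+-inverseʳ (rest 0F k ℚ.* a))
  yΨ≡0 (suc l) = proj₂ (proj₂ solution) l
  open ≡-Reasoning
  xΦ≡0 : ∀ l → x · Φ l ≡ 0ℚ
  xΦ≡0 l = begin
    x · Φ l
      ≡⟨ ℚΣ.sum-remove {i = p} (λ k → x k ℚ.* Φ l k) ⟩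
    x p ℚ.* Φ l p ℚ.+ (x ∘ punchIn p) · rest l
      ≡⟨ cong₂ (λ u v → u ℚ.* Φ l p ℚ.+ v) (insertAt-lookup scaled p _)
           (ℚΣ.sum-cong-≗ λ k → trans
             (cong (ℚ._* rest l k) (insertAt-punchIn scaled p _ k))
             (ℚ.*-assoc a (y k) (rest l k))) ⟩
    ℚ.- (y · rest 0F) ℚ.* Φ l p ℚ.+ sumℚ (λ k → a ℚ.* (y k ℚ.* rest l k))
      ≡⟨ cong (ℚ.- (y · rest 0F) ℚ.* Φ l p ℚ.+_)
           (ℚΣ.*-distribˡ-sum a (λ k → y k ℚ.* rest l k)) ⟨
    ℚ.- (y · rest 0F) ℚ.* Φ l p ℚ.+ a ℚ.* y · rest l
      ≡⟨ solve 4 (λ b c a d → :- b :* c :+ a :* d := a :* d :- b :* c) refl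
           (y · rest 0F) (Φ l p) a (y · rest l) ⟩
    a ℚ.* y · rest l ℚ.- y · rest 0F ℚ.* Φ l p
      ≡⟨ ·-combine y (rest l) (rest 0F) a (Φ l p) ⟨
    y · Ψ l
      ≡⟨ yΨ≡0 l ⟩
    0ℚ ∎
    where open +-*-Solver

-- Coordinate vectors and step vectors

δ : Fin n → Fin n → ℚ
δ zero    zero    = 1ℚ
δ zero    (suc j) = 0ℚ
δ (suc i) zero    = 0ℚ
δ (suc i) (suc j) = δ i j

δ-refl : ∀ (i : Fin n) → δ i i ≡ 1ℚ
δ-refl zero    = refl
δ-refl (suc i) = δ-refl i

δ-≢ : ∀ {i j : Fin n} → i ≢ j → δ i j ≡ 0ℚ
δ-≢ {i = zero}  {zero}  i≢j = contradiction refl i≢j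
δ-≢ {i = zero}  {suc j} i≢j = refl
δ-≢ {i = suc i} {zero}  i≢j = refl
δ-≢ {i = suc i} {suc j} i≢j = δ-≢ (i≢j ∘ cong suc)

δ-gram : ∀ (i j : Fin n) → sumℚ (λ t → δ t i ℚ.* δ t j) ≡ δ i j
δ-gram {suc n} zero zero = cong (1ℚ ℚ.+_) (ℚΣ.sum-replicate-zero n)
δ-gram {suc n} zero (suc j) = trans (ℚ.+-identityˡ _)
  (trans (ℚΣ.sum-cong-≗ λ t → ℚ.*-zeroˡ (δ t j)) (ℚΣ.sum-replicate-zero n))
δ-gram {suc n} (suc i) zero = trans (ℚ.+-identityˡ _)
  (trans (ℚΣ.sum-cong-≗ λ t → ℚ.*-zeroʳ (δ t i)) (ℚΣ.sum-replicate-zero n))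
δ-gram (suc i) (suc j) = trans (ℚ.+-identityˡ _) (δ-gram i j)

-- The indicator of t ≤ i.
step : ℕ → Fin n → ℚ
step zero    i       = 1ℚ
step (suc t) zero    = 0ℚ
step (suc t) (suc i) = step t i

step-≥ : ∀ {t} → n ≤ t → (i : Fin n) → step t i ≡ 0ℚ
step-≥ (s≤s n≤t) zero    = refl
step-≥ (s≤s n≤t) (suc i) = step-≥ n≤t i

δ-step : ∀ (i j : Fin n) → δ i j ≡ step (toℕ i) j ℚ.- step (suc (toℕ i)) j
δ-step zero    zero    = refl
δ-step zero    (suc j) = refl
δ-step (suc i) zero    = refl
δ-step (suc i) (suc j) = δ-step i j

-- Each `δ i` is a difference of two consecutive steps. Trading coordinates for steps pays because
-- `step 0` is constantly one, whatever the index type.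
·-step⇒·-δ : ∀ (x : Vector ℚ s) (u : Fin s → Fin n) →
  (∀ (t : Fin n) → x · (step (toℕ t) ∘ u) ≡ 0ℚ) → ∀ i → x · (δ i ∘ u) ≡ 0ℚ
·-step⇒·-δ {n = n} x u vanish i = begin
  x · (δ i ∘ u)
    ≡⟨ ·-congʳ x (δ-step i ∘ u) ⟩
  x · (λ k → step (toℕ i) (u k) ℚ.- step (suc (toℕ i)) (u k))
    ≡⟨ ·-distribˡ-- x (step (toℕ i) ∘ u) (step (suc (toℕ i)) ∘ u) ⟩
  x · (step (toℕ i) ∘ u) ℚ.- x · (step (suc (toℕ i)) ∘ u)
    ≡⟨ cong₂ ℚ._-_ (vanish i) (vanishℕ (suc (toℕ i))) ⟩
  0ℚ ∎
  where
  open ≡-Reasoning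
  vanishℕ : ∀ t → x · (step t ∘ u) ≡ 0ℚ
  vanishℕ t with t ℕ.<? n
  ... | yes t<n = subst (λ t → x · (step t ∘ u) ≡ 0ℚ) (Fin.toℕ-fromℕ< t<n) (vanish (fromℕ< t<n))
  -- The last coordinate needs the threshold `n`, which `vanish` does not cover; there the step is
  -- zero.
  ... | no  t≮n = ·-zeroʳ x (step-≥ (ℕ.≮⇒≥ t≮n) ∘ u)

-- The conditions for step 0 ∘ u and step 0 ∘ v coincide, which saves one of
-- the n + m equations.
balanced-relation : ∀ (u : Fin s → Fin (suc n)) (v : Fin s → Fin (suc m)) →
  n + suc m < s → ∃ λ x → (∃ λ k → x k ≢ 0ℚ) ×
    (∀ i → x · (δ i ∘ u) ≡ 0ℚ) × (∀ j → x · (δ j ∘ v) ≡ 0ℚ)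
balanced-relation {s} {n} {m} u v n+1+m<s =
  x , proj₁ (proj₂ solution) , ·-step⇒·-δ x u rows , ·-step⇒·-δ x v columns
  where
  equation : Fin n ⊎ Fin (suc m) → Vector ℚ s
  equation (inj₁ t) = step (suc (toℕ t)) ∘ u
  equation (inj₂ t) = step (toℕ t) ∘ v
  solution = underdetermined n+1+m<s (equation ∘ splitAt n)
  x = proj₁ solution
  columns : ∀ (t : Fin (suc m)) → x · (step (toℕ t) ∘ v) ≡ 0ℚ
  columns t = subst (λ e → x · equation e ≡ 0ℚ)
    (Fin.splitAt-↑ʳ n (suc m) t) (proj₂ (proj₂ solution) (n ↑ʳ t))
  rows : ∀ (t : Fin (suc n)) → x · (step (toℕ t) ∘ u) ≡ 0ℚ
  -- Both conditions unfold to the same sum, since `step zero` ignores its index; this supplies the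
  -- threshold 0 omitted from `equation` for `u`.
  rows zero    = columns 0F
  rows (suc t) = subst (λ e → x · equation e ≡ 0ℚ)
    (Fin.splitAt-↑ˡ n t (suc m)) (proj₂ (proj₂ solution) (t ↑ˡ suc m))

-- Quadratic forms of Gram matrices

form : (Fin N → Fin N → ℚ) → Vector ℚ N → ℚ
form B x = sumℚ λ p → sumℚ λ q → x p ℚ.* (B p q ℚ.* x q)

form-+ : ∀ (B C : Fin N → Fin N → ℚ) x →
  form (λ p q → B p q ℚ.+ C p q) x ≡ form B x ℚ.+ form C x
form-+ B C x = trans
  (ℚΣ.sum-cong-≗ λ p → trans
    (ℚΣ.sum-cong-≗ λ q → solve 4
      (λ x b c y → x :* ((b :+ c) :* y) := x :* (b :* y) :+ x :* (c :* y)) refl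
      (x p) (B p q) (C p q) (x q))
    (ℚΣ.∑-distrib-+ (λ q → x p ℚ.* (B p q ℚ.* x q)) (λ q → x p ℚ.* (C p q ℚ.* x q))))
  (ℚΣ.∑-distrib-+ (λ p → sumℚ λ q → x p ℚ.* (B p q ℚ.* x q))
                  (λ p → sumℚ λ q → x p ℚ.* (C p q ℚ.* x q)))
  where open +-*-Solver

0≤p² : ∀ p → 0ℚ ℚ.≤ p ℚ.* p
0≤p² p = subst (0ℚ ℚ.≤_) ∣p∣²≡p²
  (subst (ℚ._≤ ∣ p ∣ ℚ.* ∣ p ∣) (ℚ.*-zeroˡ ∣ p ∣)
    (ℚ.*-monoʳ-≤-nonNeg ∣ p ∣ {{ℚ.∣-∣-nonNeg p}} (ℚ.0≤∣p∣ p)))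
  where
  ∣p∣²≡p² : ∣ p ∣ ℚ.* ∣ p ∣ ≡ p ℚ.* p
  ∣p∣²≡p² with ℚ.∣p∣≡p∨∣p∣≡-p p
  ... | inj₁ eq = cong₂ ℚ._*_ eq eq
  ... | inj₂ eq = trans (cong₂ ℚ._*_ eq eq) (solve 1 (λ p → :- p :* :- p := p :* p) refl p)
    where open +-*-Solver

sumℚ-nonNeg : ∀ (t : Vector ℚ d) → (∀ i → 0ℚ ℚ.≤ t i) → 0ℚ ℚ.≤ sumℚ t
sumℚ-nonNeg {zero}  t 0≤t = ℚ.≤-refl
sumℚ-nonNeg {suc d} t 0≤t = ℚ.+-mono-≤ (0≤t 0F) (sumℚ-nonNeg (t ∘ suc) (0≤t ∘ suc))

-- Distributing and exchanging the sums turns the form of a Gram matrix into a sum of squares, from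
-- which positivity is read off.
form-gram : ∀ (w : Fin d → Vector ℚ N) x →
  form (λ p q → sumℚ λ t → w t p ℚ.* w t q) x ≡ sumℚ λ t → (x · w t) ℚ.* (x · w t)
form-gram w x = begin
  (sumℚ λ p → sumℚ λ q → x p ℚ.* (sumℚ (λ t → w t p ℚ.* w t q) ℚ.* x q))
    ≡⟨ ℚΣ.sum-cong-≗ (λ p → ℚΣ.sum-cong-≗ (inner p)) ⟩
  (sumℚ λ p → sumℚ λ q → sumℚ λ t → a t p ℚ.* a t q)
    ≡⟨ ℚΣ.sum-cong-≗ (λ p → ℚΣ.∑-comm λ q t → a t p ℚ.* a t q) ⟩
  (sumℚ λ p → sumℚ λ t → sumℚ λ q → a t p ℚ.* a t q)
    ≡⟨ ℚΣ.∑-comm (λ p t → sumℚ λ q → a t p ℚ.* a t q) ⟩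
  (sumℚ λ t → sumℚ λ p → sumℚ λ q → a t p ℚ.* a t q)
    ≡⟨ ℚΣ.sum-cong-≗ (λ t → trans
         (ℚΣ.sum-cong-≗ λ p → sym (ℚΣ.*-distribˡ-sum (a t p) (a t)))
         (sym (ℚΣ.*-distribʳ-sum (sumℚ (a t)) (a t)))) ⟩
  (sumℚ λ t → (x · w t) ℚ.* (x · w t)) ∎
  where
  open ≡-Reasoning
  open +-*-Solver using (solve; _:*_; _:=_)
  a : _ → _ → ℚ
  a t p = x p ℚ.* w t p
  inner : ∀ p q → x p ℚ.* (sumℚ (λ t → w t p ℚ.* w t q) ℚ.* x q) ≡ sumℚ λ t → a t p ℚ.* a t q
  inner p q = begin
    x p ℚ.* (sumℚ (λ t → w t p ℚ.* w t q) ℚ.* x q)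
      ≡⟨ cong (x p ℚ.*_) (ℚΣ.*-distribʳ-sum (x q) (λ t → w t p ℚ.* w t q)) ⟩
    x p ℚ.* sumℚ (λ t → w t p ℚ.* w t q ℚ.* x q)
      ≡⟨ ℚΣ.*-distribˡ-sum (x p) (λ t → w t p ℚ.* w t q ℚ.* x q) ⟩
    sumℚ (λ t → x p ℚ.* (w t p ℚ.* w t q ℚ.* x q))
      ≡⟨ ℚΣ.sum-cong-≗ (λ t → solve 4
           (λ x v w y → x :* (v :* w :* y) := x :* v :* (y :* w)) refl
           (x p) (w t p) (w t q) (x q)) ⟩
    sumℚ (λ t → a t p ℚ.* a t q) ∎

-- By `δ-gram`, this is the Gram matrix of the basis vectors indexed by `u p`.
form-δ-nonNeg : ∀ (u : Fin N → Fin n) x → 0ℚ ℚ.≤ form (λ p q → δ (u p) (u q)) x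
form-δ-nonNeg u x = subst (0ℚ ℚ.≤_)
  (trans (sym (form-gram (λ t → δ t ∘ u) x))
    (ℚΣ.sum-cong-≗ λ p → ℚΣ.sum-cong-≗ λ q →
      cong (λ b → x p ℚ.* (b ℚ.* x q)) (δ-gram (u p) (u q))))
  (sumℚ-nonNeg _ λ t → 0≤p² (x · (δ t ∘ u)))

-- Real numbers

seq-sum : ∀ (t : Vector ℝ d) j → seq (D.sum t) j ≡ sumℚ (λ i → seq (t i) j)
seq-sum {zero}  t j = refl
seq-sum {suc d} t j = cong (seq (t 0F) j ℚ.+_) (seq-sum (t ∘ suc) j)

≗⇒≈ : ∀ {x y} → (∀ j → seq x j ≡ seq y j) → x D.≈ y
≗⇒≈ {x} {y} x≗y ε 0<ε = 0 , λ j _ → subst (λ t → ∣ t ∣ ℚ.< ε)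
  (sym (trans (cong (ℚ._- seq y j) (x≗y j)) (ℚ.+-inverseʳ (seq y j)))) 0<ε

+-cong : ∀ {x y u v} → x D.≈ y → u D.≈ v → (x D.+ u) D.≈ (y D.+ v)
+-cong {x} {y} {u} {v} x≈y u≈v ε 0<ε =
  let N₁ , h₁ = x≈y (½ ℚ.* ε) (half-pos ε 0<ε)
      N₂ , h₂ = u≈v (½ ℚ.* ε) (half-pos ε 0<ε)
  in  N₁ ⊔ N₂ , λ j N≤j → subst (λ t → ∣ t ∣ ℚ.< ε)
        (solve 4 (λ a b c d → (a :- b) :+ (c :- d) := (a :+ c) :- (b :+ d)) refl
          (seq x j) (seq y j) (seq u j) (seq v j))
        (D.∣+∣<ε _ _ ε (h₁ j (ℕ.m⊔n≤o⇒m≤o N₁ N₂ N≤j)) (h₂ j (ℕ.m⊔n≤o⇒n≤o N₁ N₂ N≤j)))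
  where open +-*-Solver

+-0-commutativeMonoid : CommutativeMonoid 0ℓ 0ℓ
+-0-commutativeMonoid = record
  { _≈_ = D._≈_
  ; _∙_ = D._+_
  ; ε = 0ℝ
  ; isCommutativeMonoid = record
    { isMonoid = record
      { isSemigroup = record
        { isMagma = record
          { isEquivalence = record
            { refl  = λ {x} → ≗⇒≈ {x} {x} λ _ → refl
            ; sym   = λ {x} {y} → D.≈-sym {x} {y}
            ; trans = λ {x} {y} {z} → D.≈-trans {x} {y} {z}
            }
          ; ∙-cong = λ {x} {y} {u} {v} → +-cong {x} {y} {u} {v}
          }
        ; assoc = λ x y z → ≗⇒≈ {(x D.+ y) D.+ z} {x D.+ (y D.+ z)}
            λ j → ℚ.+-assoc (seq x j) (seq y j) (seq z j)
        }
      ; identity = (λ x → ≗⇒≈ {0ℝ D.+ x} {x} λ j → ℚ.+-identityˡ (seq x j))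
                 , (λ x → ≗⇒≈ {x D.+ 0ℝ} {x} λ j → ℚ.+-identityʳ (seq x j))
      }
    ; comm = λ x y → ≗⇒≈ {x D.+ y} {y D.+ x} λ j → ℚ.+-comm (seq x j) (seq y j)
    }
  }

module ℝΣ = CommutativeMonoidSum +-0-commutativeMonoid

sum-single : ∀ (t : Vector ℝ d) l → (∀ i → i ≢ l → t i D.≈ 0ℝ) → D.sum t D.≈ t l
sum-single {suc d} t l others = begin
  D.sum t
    ≈⟨ ℝΣ.sum-remove {i = l} t ⟩
  t l D.+ D.sum (t ∘ punchIn l)
    ≈⟨ ∙-congˡ {t l} {D.sum (t ∘ punchIn l)} {D.sum {d} (λ _ → 0ℝ)}
         (ℝΣ.sum-cong-≋ {x = t ∘ punchIn l} {y = λ _ → 0ℝ}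
           λ i → others (punchIn l i) (Fin.punchInᵢ≢i l i)) ⟩
  t l D.+ D.sum {d} (λ _ → 0ℝ)
    ≈⟨ ∙-congˡ {t l} {D.sum {d} (λ _ → 0ℝ)} {0ℝ} (ℝΣ.sum-replicate-zero d) ⟩
  t l D.+ 0ℝ
    ≈⟨ identityʳ (t l) ⟩
  t l ∎
  where
  open CommutativeMonoid +-0-commutativeMonoid using (∙-congˡ; identityʳ; setoid)
  open import Relation.Binary.Reasoning.Setoid setoid

∣p-0∣≡∣p∣ : ∀ p → ∣ p ℚ.- 0ℚ ∣ ≡ ∣ p ∣
∣p-0∣≡∣p∣ p = cong ∣_∣ (ℚ.+-identityʳ p)

fromℚ≈0⇒≡0 : ∀ q → fromℚ q D.≈ 0ℝ → q ≡ 0ℚ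
fromℚ≈0⇒≡0 q q≈0 = decidable-stable (q ℚ.≟ 0ℚ) λ q≢0 →
  -- With `∣ q ∣` itself as tolerance, the constant sequence would give `∣ q ∣ < ∣ q ∣`.
  let N , h = q≈0 ∣ q ∣ (ℚ.≰⇒> λ ∣q∣≤0 →
                q≢0 (ℚ.∣p∣≡0⇒p≡0 q (ℚ.≤-antisym ∣q∣≤0 (ℚ.0≤∣p∣ q))))
  in  ℚ.<-irrefl (∣p-0∣≡∣p∣ q) (h N ℕ.≤-refl)

combination≈0 : ∀ (c v : Vector ℝ s) (x y : Vector ℚ s) →
  (∀ k j → seq (c k) j ≡ x k) → (∀ k j → seq (v k) j ≡ y k) →
  x · y ≡ 0ℚ → D.sum (λ k → c k D.* v k) D.≈ 0ℝ
combination≈0 c v x y c≗x v≗y x·y≡0 =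
  ≗⇒≈ {D.sum (λ k → c k D.* v k)} {0ℝ} λ j → trans
    (seq-sum (λ k → c k D.* v k) j)
    (trans (ℚΣ.sum-cong-≗ λ k → cong₂ ℚ._*_ (c≗x k j) (v≗y k j)) x·y≡0)

-- A rational relation is in particular a real one. Hence, for vectors with constant rational
-- entries, rational elimination already bounds the size of independent families.
independent⇒trivial-relation : ∀ (v : Fin s → Vector ℝ N) → LinearlyIndependent v →
  ∀ (b : Fin N → Vector ℚ s) → (∀ k i j → seq (v k i) j ≡ b i k) →
  ∀ x → (∀ i → x · b i ≡ 0ℚ) → ∀ k → x k ≡ 0ℚ
independent⇒trivial-relation v independent b v≗b x x·b≡0 k = fromℚ≈0⇒≡0 (x k)
  (independent (λ k → fromℚ (x k))
    (λ i → combination≈0 (λ k → fromℚ (x k)) (λ k → v k i) x (b i)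
      (λ _ _ → refl) (λ k j → v≗b k i j) (x·b≡0 i))
    k)

*-zeroʳ-≈ : ∀ x {y} → y D.≈ 0ℝ → (x D.* y) D.≈ 0ℝ
*-zeroʳ-≈ x {y} y≈0 ε 0<ε =
  let B , 0<B , N₁ , x≤B = D.bounded x
      η , 0<η , small = D.shrink B ε 0<B 0<ε
      N₂ , h = y≈0 η 0<η
  in  N₁ ⊔ N₂ , λ j N≤j → subst (ℚ._< ε) (sym (∣p-0∣≡∣p∣ (seq x j ℚ.* seq y j)))
        (small (seq x j) (seq y j) (x≤B j (ℕ.m⊔n≤o⇒m≤o N₁ N₂ N≤j))
          (subst (ℚ._< η) (∣p-0∣≡∣p∣ (seq y j)) (h j (ℕ.m⊔n≤o⇒n≤o N₁ N₂ N≤j))))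

*-zeroˡ-≈ : ∀ {x} y → x D.≈ 0ℝ → (x D.* y) D.≈ 0ℝ
*-zeroˡ-≈ {x} y x≈0 = D.≈-trans {x D.* y} {y D.* x} {0ℝ}
  (≗⇒≈ {x D.* y} {y D.* x} λ j → ℚ.*-comm (seq x j) (seq y j))
  (*-zeroʳ-≈ y {x} x≈0)

-- Apartness from zero: the explicit bound `η` is what division estimates need and what `¬ (a ≈ 0ℝ)`
-- does not exhibit.
AwayFromZero : ℝ → Set
AwayFromZero a = ∃ λ η → 0ℚ ℚ.< η × D.Eventually λ j → η ℚ.≤ ∣ seq a j ∣

∣p∣-bound : ∀ ε η p q → 0ℚ ℚ.< ε → η ℚ.≤ ∣ q ∣ → ∣ p ℚ.* q ∣ ℚ.< ε ℚ.* η → ∣ p ∣ ℚ.< ε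
∣p∣-bound ε η p q 0<ε η≤∣q∣ small = ℚ.*-cancelʳ-<-nonNeg ∣ q ∣ {{ℚ.∣-∣-nonNeg q}} (begin-strict
  ∣ p ∣ ℚ.* ∣ q ∣   ≡⟨ ℚ.∣p*q∣≡∣p∣*∣q∣ p q ⟨
  ∣ p ℚ.* q ∣       <⟨ small ⟩
  ε ℚ.* η           ≤⟨ ℚ.*-monoˡ-≤-nonNeg ε {{ℚ.pos⇒nonNeg ε {{ℚ.positive 0<ε}}}} η≤∣q∣ ⟩
  ε ℚ.* ∣ q ∣       ∎)
  where open ℚ.≤-Reasoning

0<p*q : ∀ p q → 0ℚ ℚ.< p → 0ℚ ℚ.< q → 0ℚ ℚ.< p ℚ.* q
0<p*q p q 0<p 0<q = subst (ℚ._< p ℚ.* q) (ℚ.*-zeroʳ p)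
  (ℚ.*-monoʳ-<-pos p {{ℚ.positive 0<p}} 0<q)

-- No inverse is built: once `η` bounds `∣ a ∣` from below, tolerance `ε * η` on the product forces
-- tolerance `ε` on `x`.
away-cancel : ∀ x a → AwayFromZero a → (x D.* a) D.≈ 0ℝ → x D.≈ 0ℝ
away-cancel x a (η , 0<η , N₁ , away) xa≈0 ε 0<ε =
  let N₂ , h = xa≈0 (ε ℚ.* η) (0<p*q ε η 0<ε 0<η)
  in  N₁ ⊔ N₂ , λ j N≤j → subst (ℚ._< ε) (sym (∣p-0∣≡∣p∣ (seq x j)))
        (∣p∣-bound ε η (seq x j) (seq a j) 0<ε (away j (ℕ.m⊔n≤o⇒m≤o N₁ N₂ N≤j))
          (subst (ℚ._< ε ℚ.* η) (∣p-0∣≡∣p∣ (seq x j ℚ.* seq a j))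
            (h j (ℕ.m⊔n≤o⇒n≤o N₁ N₂ N≤j))))

-- Classical cancellation and triangular independence

module Classical (em : ExcludedMiddle 0ℓ) where

  -- From `M` on, the sequence oscillates by less than a quarter of `ε`. If its term at `M` had size
  -- at least half of `ε`, all later terms would have size at least a quarter, so `a` would be away
  -- from zero. Otherwise the whole tail lies below `ε`.
  ≉0⇒away : ∀ a → ¬ (a D.≈ 0ℝ) → AwayFromZero a
  ≉0⇒away a a≉0 = decidable-stable em λ ¬away → a≉0 λ ε 0<ε →
    let δ       = ½ ℚ.* (½ ℚ.* ε)
        0<½ε    = half-pos ε 0<ε
        0<δ     = half-pos (½ ℚ.* ε) 0<½ε
        δ<½ε    = subst₂ ℚ._<_ (ℚ.+-identityʳ δ) (halves (½ ℚ.* ε)) (ℚ.+-monoʳ-< δ 0<δ)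
        M , h   = cauchy a δ 0<δ
        ∣aM∣<½ε = ℚ.≰⇒> λ ½ε≤∣aM∣ → ¬away (δ , 0<δ , M , λ j M≤j → ℚ.≮⇒≥ λ ∣aj∣<δ →
          ℚ.<-irrefl refl (ℚ.≤-<-trans ½ε≤∣aM∣ (subst (λ t → ∣ t ∣ ℚ.< ½ ℚ.* ε)
            (restore (seq a M) (seq a j))
            (D.∣+∣<ε _ _ (½ ℚ.* ε) (h M j ℕ.≤-refl M≤j) ∣aj∣<δ))))
    in  M , λ j M≤j → subst (ℚ._< ε)
          (trans (cong ∣_∣ (restore (seq a j) (seq a M))) (sym (∣p-0∣≡∣p∣ (seq a j))))
          (D.∣+∣<ε _ _ ε (ℚ.<-trans (h j M M≤j ℕ.≤-refl) δ<½ε) ∣aM∣<½ε)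
    where
    restore : ∀ p q → (p ℚ.- q) ℚ.+ q ≡ p
    restore = solve 2 (λ p q → (p :- q) :+ q := p) refl
      where open +-*-Solver

  *-cancelʳ-≈0 : ∀ x a → ¬ (a D.≈ 0ℝ) → (x D.* a) D.≈ 0ℝ → x D.≈ 0ℝ
  *-cancelʳ-≈0 x a a≉0 = away-cancel x a (≉0⇒away a a≉0)

  -- Strong induction on `level`. At `row k` the relation loses the terms with zero entry and those
  -- of lower level, whose coefficients already vanish; what remains is `c k` times a nonzero entry.
  triangular⇒independent : ∀ (v : Fin s → Vector ℝ N) (row : Fin s → Fin N) (level : Fin s → ℕ) →
    (∀ k → ¬ (v k (row k) D.≈ 0ℝ)) →
    (∀ k l → l ≢ k → v l (row k) D.≈ 0ℝ ⊎ level l < level k) →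
    LinearlyIndependent v
  triangular⇒independent {s} v row level diagonal off c relation k =
    <-rec P vanish (level k) k refl
    where
    P : ℕ → Set
    P ρ = ∀ k → level k ≡ ρ → c k D.≈ 0ℝ
    vanish : ∀ ρ → (∀ {σ} → σ < ρ → P σ) → P ρ
    vanish ρ below k refl = *-cancelʳ-≈0 (c k) (v k (row k)) (diagonal k)
      (D.≈-trans {term k} {D.sum term} {0ℝ}
        (D.≈-sym {D.sum term} {term k} (sum-single term k others))
        (relation (row k)))
      where
      term : Vector ℝ s
      term l = c l D.* v l (row k)
      others : ∀ l → l ≢ k → term l D.≈ 0ℝ
      others l l≢k = [ (λ v≈0 → *-zeroʳ-≈ (c l) {v l (row k)} v≈0)
                     , (λ l<k → *-zeroˡ-≈ {c l} (v l (row k)) (below l<k l refl))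
                     ]′ (off k l l≢k)

  -- `𝒢` records a nonzero entry as a negation, so non-adjacency yields a double negation; excluded
  -- middle removes it.
  nonadjacent⇒≈0 : ∀ {G : SimpleGraph (Fin N)} {B} → PSDRealization G B →
    ∀ {i j} → i ≢ j → ¬ Adj G i j → B i j D.≈ 0ℝ
  nonadjacent⇒≈0 (_ , _ , iso) {i} {j} i≢j ¬adj =
    decidable-stable em λ Bij≉0 → ¬adj (Equivalence.to (iso i j) (i≢j , Bij≉0))

  -- Independent columns in an arbitrary realization

  module _ (φ : Fin N ↔ (Fin (2 + n) × Fin (2 + m))) where

    private
      Index : Set
      Index = Fin n ⊎ Fin (2 + m)

      -- Each `target` is a chosen column and its `source` the row that tests it. The corner
      -- `(0F , 0F)` is counted in the second family, which leaves `n` vertices for the first.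
      target source : Index → Fin (2 + n) × Fin (2 + m)
      target (inj₁ i)       = suc (suc i) , 0F
      target (inj₂ j)       = 0F , j
      source (inj₁ i)       = suc (suc i) , 1F
      source (inj₂ zero)    = 0F , 1F
      source (inj₂ (suc j)) = 1F , suc j

      -- Two levels suffice: inside a level the submatrix is diagonal, and rows of level 0 vanish on
      -- columns of level 1.
      level : Index → ℕ
      level (inj₂ (suc j)) = 0
      level _              = 1

      adjacent : ∀ a → Adj (K (2 + n) □ K (2 + m)) (source a) (target a)
      adjacent (inj₁ i)       = inj₁ (refl , λ ())
      adjacent (inj₂ zero)    = inj₁ (refl , λ ())
      adjacent (inj₂ (suc j)) = inj₂ (refl , λ ())

      -- In a rook graph this is exactly being distinct and non-adjacent.
      Separated : Fin (2 + n) × Fin (2 + m) → Fin (2 + n) × Fin (2 + m) → Set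
      Separated (u , v) (u′ , v′) = u ≢ u′ × v ≢ v′

      separated : ∀ a b → b ≢ a → Separated (source a) (target b) ⊎ level b < level a
      separated (inj₁ i)       (inj₁ i′)       b≢a =
        inj₁ ((λ eq → b≢a (cong inj₁ (sym (Fin.suc-injective (Fin.suc-injective eq))))) , λ ())
      separated (inj₁ i)       (inj₂ zero)     b≢a = inj₁ ((λ ()) , λ ())
      separated (inj₁ i)       (inj₂ (suc j))  b≢a = inj₂ (s≤s z≤n)
      separated (inj₂ zero)    (inj₁ i)        b≢a = inj₁ ((λ ()) , λ ())
      separated (inj₂ zero)    (inj₂ zero)     b≢a = contradiction refl b≢a
      -- Row `(0F , 1F)` shares its first coordinate with all these columns and coincides with one
      -- of them, so only the level helps.
      separated (inj₂ zero)    (inj₂ (suc j))  b≢a = inj₂ (s≤s z≤n)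
      separated (inj₂ (suc j)) (inj₁ i)        b≢a = inj₁ ((λ ()) , λ ())
      separated (inj₂ (suc j)) (inj₂ zero)     b≢a = inj₁ ((λ ()) , λ ())
      separated (inj₂ (suc j)) (inj₂ (suc j′)) b≢a =
        inj₁ ((λ ()) , λ eq → b≢a (cong inj₂ (sym eq)))

      splitAt-injective : ∀ {k l} → splitAt n {2 + m} k ≡ splitAt n l → k ≡ l
      splitAt-injective {k} {l} eq = trans (sym (Fin.join-splitAt n (2 + m) k))
        (trans (cong (join n (2 + m)) eq) (Fin.join-splitAt n (2 + m) l))

      open Inverse φ using (to; from; strictlyInverseˡ)

    rook-independent : ∀ {B} → PSDRealization (relabel φ (K (2 + n) □ K (2 + m))) B →
      IndependentColumns B (n + (2 + m))
    rook-independent {B} realization@(_ , _ , iso) = column ,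
      triangular⇒independent (D.column B ∘ column) row (level ∘ splitAt n) diagonal off
      where
      column row : Fin (n + (2 + m)) → Fin N
      column = from ∘ target ∘ splitAt n
      row    = from ∘ source ∘ splitAt n
      diagonal : ∀ k → ¬ (B (row k) (column k) D.≈ 0ℝ)
      diagonal k = proj₂ (Equivalence.from (iso (row k) (column k))
        (subst₂ (Adj (K (2 + n) □ K (2 + m)))
          (sym (strictlyInverseˡ (source (splitAt n k))))
          (sym (strictlyInverseˡ (target (splitAt n k))))
          (adjacent (splitAt n k))))
      separated⇒≈0 : ∀ p q → Separated p q → B (from p) (from q) D.≈ 0ℝ
      separated⇒≈0 p q (u≢u′ , v≢v′) =
        nonadjacent⇒≈0 {G = relabel φ (K (2 + n) □ K (2 + m))} {B} realization
          (λ eq → u≢u′ (cong proj₁ (trans (sym (strictlyInverseˡ p))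
            (trans (cong to eq) (strictlyInverseˡ q)))))
          (¬adj ∘ subst₂ (Adj (K (2 + n) □ K (2 + m))) (strictlyInverseˡ p) (strictlyInverseˡ q))
        where
        ¬adj : ¬ Adj (K (2 + n) □ K (2 + m)) p q
        ¬adj (inj₁ (u≡u′ , _)) = u≢u′ u≡u′
        ¬adj (inj₂ (v≡v′ , _)) = v≢v′ v≡v′
      off : ∀ k l → l ≢ k →
        B (row k) (column l) D.≈ 0ℝ ⊎ level (splitAt n l) < level (splitAt n k)
      off k l l≢k = map₁ (separated⇒≈0 (source (splitAt n k)) (target (splitAt n l)))
        (separated (splitAt n k) (splitAt n l) (l≢k ∘ splitAt-injective))

-- A Gram matrix realizing the rook graph

module RookMatrix (φ : Fin N ↔ (Fin (suc n) × Fin (suc m))) where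

  open Inverse φ using (to; from; strictlyInverseʳ)

  row : Fin N → Fin (suc n)
  row = proj₁ ∘ to

  col : Fin N → Fin (suc m)
  col = proj₂ ∘ to

  -- The adjacency matrix of the rook graph plus twice the identity: the Gram matrix of the edge
  -- vectors of a complete bipartite graph.
  entry : Fin N → Fin N → ℚ
  entry i j = δ (row i) (row j) ℚ.+ δ (col i) (col j)

  matrix : Matrix N
  matrix i j = fromℚ (entry i j)

  δ-sym : ∀ {n} (i j : Fin n) → δ i j ≡ δ j i
  δ-sym zero    zero    = refl
  δ-sym zero    (suc j) = refl
  δ-sym (suc i) zero    = refl
  δ-sym (suc i) (suc j) = δ-sym i j

  matrix-symmetric : D.Symmetric matrix
  matrix-symmetric i j = ≗⇒≈ {matrix i j} {matrix j i} λ _ →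
    cong₂ ℚ._+_ (δ-sym (row i) (row j)) (δ-sym (col i) (col j))

  matrix-psd : D.PositiveSemidefinite matrix
  -- The row part and the column part of the form are nonnegative at every index, so the threshold
  -- is 0 and `ε` is mere slack.
  matrix-psd x ε 0<ε = 0 , λ l _ → subst (λ t → 0ℚ ℚ.≤ t ℚ.+ ε) (sym (seq-form l))
    (ℚ.+-mono-≤
      (ℚ.+-mono-≤ (form-δ-nonNeg row (λ i → seq (x i) l)) (form-δ-nonNeg col (λ i → seq (x i) l)))
      (ℚ.<⇒≤ 0<ε))
    where
    seq-form : ∀ l → seq (D.sum λ i → D.sum λ j → x i D.* (matrix i j D.* x j)) l ≡
      form (λ p q → δ (row p) (row q)) (λ i → seq (x i) l) ℚ.+
      form (λ p q → δ (col p) (col q)) (λ i → seq (x i) l)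
    seq-form l = trans
      (trans (seq-sum (λ i → D.sum λ j → x i D.* (matrix i j D.* x j)) l)
        (ℚΣ.sum-cong-≗ λ i → seq-sum (λ j → x i D.* (matrix i j D.* x j)) l))
      (form-+ (λ p q → δ (row p) (row q)) (λ p q → δ (col p) (col q)) (λ i → seq (x i) l))

  matrix-graph : D.𝒢 matrix matrix-symmetric D.≗ᴳ relabel φ (K (suc n) □ K (suc m))
  matrix-graph i j = mk⇔ forward backward
    where
    forward : i ≢ j × ¬ (matrix i j D.≈ 0ℝ) → Adj (K (suc n) □ K (suc m)) (to i) (to j)
    forward (i≢j , Bij≉0) = classify (row i Fin.≟ row j) (col i Fin.≟ col j)
      where
      classify : Dec (row i ≡ row j) → Dec (col i ≡ col j) →
        Adj (K (suc n) □ K (suc m)) (to i) (to j)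
      classify (yes ri≡rj) (yes ci≡cj) = contradiction
        (trans (sym (strictlyInverseʳ i))
          (trans (cong from (cong₂ _,_ ri≡rj ci≡cj)) (strictlyInverseʳ j)))
        i≢j
      classify (yes ri≡rj) (no ci≢cj) = inj₁ (ri≡rj , ci≢cj)
      classify (no ri≢rj) (yes ci≡cj) = inj₂ (ci≡cj , ri≢rj)
      classify (no ri≢rj) (no ci≢cj) = contradiction
        (≗⇒≈ {matrix i j} {0ℝ} λ _ → cong₂ ℚ._+_ (δ-≢ ri≢rj) (δ-≢ ci≢cj)) Bij≉0
    nonzero : entry i j ≡ 1ℚ → ¬ (matrix i j D.≈ 0ℝ)
    nonzero Bij≡1 Bij≈0 = 1ℚ≢0ℚ (trans (sym Bij≡1) (fromℚ≈0⇒≡0 (entry i j) Bij≈0))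
      where
      1ℚ≢0ℚ : 1ℚ ≢ 0ℚ
      1ℚ≢0ℚ ()
    backward : Adj (K (suc n) □ K (suc m)) (to i) (to j) → i ≢ j × ¬ (matrix i j D.≈ 0ℝ)
    backward (inj₁ (ri≡rj , ci≢cj)) = (λ i≡j → ci≢cj (cong col i≡j)) ,
      nonzero (cong₂ ℚ._+_ (trans (cong (δ (row i)) (sym ri≡rj)) (δ-refl (row i))) (δ-≢ ci≢cj))
    backward (inj₂ (ci≡cj , ri≢rj)) = (λ i≡j → ri≢rj (cong row i≡j)) ,
      nonzero (cong₂ ℚ._+_ (δ-≢ ri≢rj) (trans (cong (δ (col i)) (sym ci≡cj)) (δ-refl (col i))))

  realization : PSDRealization (relabel φ (K (suc n) □ K (suc m))) matrix
  realization = matrix-symmetric , matrix-psd , matrix-graph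

  -- A relation balanced in rows and columns annihilates every row of `matrix`, because `entry` is a
  -- row term plus a column term.
  independent-≤ : ∀ s → IndependentColumns matrix s → s ≤ n + suc m
  independent-≤ s (f , independent) = ℕ.≮⇒≥ λ n+1+m<s →
    let x , (k , xk≢0) , rows , cols = balanced-relation (row ∘ f) (col ∘ f) n+1+m<s
    in  xk≢0 (independent⇒trivial-relation (D.column matrix ∘ f) independent
          (λ i k → entry i (f k)) (λ _ _ _ → refl) x
          (λ i → trans (·-distribˡ-+ x (δ (row i) ∘ row ∘ f) (δ (col i) ∘ col ∘ f))
            (cong₂ ℚ._+_ (rows (row i)) (cols (col i))))
          k)

-- Deciding the minimum rank

-- Only the existence of `suc r` independent columns is open; taking it as a `Dec` leaves excluded
-- middle to the caller.
rank-dichotomy : ∀ (A : Matrix N) → IndependentColumns A r →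
  (∀ s → IndependentColumns A s → s ≤ suc r) → Dec (IndependentColumns A (suc r)) →
  HasRank A (suc r) ⊎ HasRank A r
rank-dichotomy A indᵣ bound (yes ind) = inj₁ (ind , bound)
rank-dichotomy A indᵣ bound (no ¬ind) = inj₂ (indᵣ , λ s indₛ →
  ℕ.≤-pred (ℕ.≤∧≢⇒< (bound s indₛ) λ s≡1+r →
    ¬ind (subst (IndependentColumns A) s≡1+r indₛ)))

module _ (em : ExcludedMiddle 0ℓ) (φ : Fin N ↔ (Fin (2 + n) × Fin (2 + m))) where

  open Classical em
  open RookMatrix φ using (matrix; realization; independent-≤)

  private
    G : SimpleGraph (Fin N)
    G = relabel φ (K (2 + n) □ K (2 + m))

    -- Written so that the sum of the orders `2 + n` and `2 + m`, less two or less one, computes to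
    -- `r₀` or `suc r₀`.
    r₀ : ℕ
    r₀ = n + (2 + m)

    Attained : ℕ → Set
    Attained r = ∃ λ B → PSDRealization G B × HasRank B r

  rook-rank-≥ : ∀ B s → PSDRealization G B → HasRank B s → r₀ ≤ s
  rook-rank-≥ B s real (_ , maximal) = maximal r₀ (rook-independent φ {B} real)

  -- If no realization has rank `r₀`, all ranks of realizations exceed it, and `matrix`, of rank at
  -- most `suc r₀`, attains the minimum.
  rook-mr₊ : Dec (Attained r₀) → ∃ λ r → IsMr₊ G r × (r ≡ r₀ ⊎ r ≡ suc r₀)
  rook-mr₊ (yes attained) = r₀ , (attained , rook-rank-≥) , inj₁ refl
  rook-mr₊ (no ¬attained) = suc r₀ ,
    ( (matrix , realization , fromInj₁
        (λ rank≡r₀ → contradiction (matrix , realization , rank≡r₀) ¬attained)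
        -- `RookMatrix` is instantiated at `suc n` and `suc m`, so the bound of `independent-≤`
        -- computes to `suc r₀`.
        (rank-dichotomy matrix (rook-independent φ {matrix} realization) independent-≤ em))
    , λ B s real hasRank → ℕ.≤∧≢⇒< (rook-rank-≥ B s real hasRank) λ r₀≡s →
        ¬attained (B , real , subst (HasRank B) (sym r₀≡s) hasRank) ) ,
    inj₂ refl

-- The argument works for any numbering `φ` of the vertices. Matching on the inequalities exposes
-- the successors on which `∸` computes.
rook-mr₊-≥2 : ExcludedMiddle 0ℓ → ∀ n m → 2 ≤ n → 2 ≤ m → (φ : Fin N ↔ (Fin n × Fin m)) →
  ∃ λ r → IsMr₊ (relabel φ (K n □ K m)) r × (r ≡ n + m ∸ 2 ⊎ r ≡ n + m ∸ 1)
rook-mr₊-≥2 em (suc (suc n)) (suc (suc m)) (s≤s (s≤s z≤n)) (s≤s (s≤s z≤n)) φ =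
  rook-mr₊ em φ em

theorem3p10 : ExcludedMiddle 0ℓ →
    ∀ (n m : ℕ) → 2 ≤ n → 2 ≤ m →
    ∃ λ r → IsMr₊ (relabel *↔× (K n □ K m)) r × (r ≡ n + m ∸ 2 ⊎ r ≡ n + m ∸ 1)
theorem3p10 em n m 2≤n 2≤m = rook-mr₊-≥2 em n m 2≤n 2≤m *↔×
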